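{- Let $G$ be a bipartite multigraph (multiple edges allowed, no loops) with maximum degree $\Delta(G)$, let $k\ge 1$ be an integer, and let the palette be $\mathcal{K}=\{1,\dots,\Delta(G)+k\}$. Let $S\subseteq E(G)$ carry a proper edge-colouring with colours from $\mathcal{K}$ such that every vertex of $G$ is incident with at most $k$ edges of $S$. Then this precolouring can be extended to a proper edge-colouring of all of $G$ using only colours from $\mathcal{K}$.
   Context: A proper edge-colouring assigns colours to edges so that any two edges sharing an end-vertex (including parallel edges) receive distinct colours. Extending a precolouring means producing a proper edge-colouring of all of $G$ agreeing with the given colours on $S$. -}

module Defs where

open import Data.Nat using (ℕ; _+_; _≤_; _⊔_)
open import Data.Fin using (Fin)
open import Data.Fin.Properties using (_≟_)
open import Data.Bool using (Bool; true; false; not; _∨_; _∧_)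
open import Data.Sum using (_⊎_)
open import Data.Product using (Σ)
open import Data.List using (List; length; filter; allFin; foldr)
open import Data.Maybe using (Maybe; just; nothing)
open import Data.Product using (_×_; _,_)
open import Relation.Binary.PropositionalEquality using (_≡_; _≢_)
open import Relation.Nullary.Decidable using (⌊_⌋)

record Multigraph (n m : ℕ) : Set where
  field
    end₁ : Fin m → Fin n
    end₂ : Fin m → Fin n
open Multigraph public

Incident : ∀ {n m} → Multigraph n m → Fin n → Fin m → Set
Incident G v e = (end₁ G e ≡ v) ⊎ (end₂ G e ≡ v)

incident? : ∀ {n m} → Multigraph n m → Fin n → Fin m → Bool
incident? G v e = ⌊ end₁ G e ≟ v ⌋ ∨ ⌊ end₂ G e ≟ v ⌋

-- bipartite: there is a 2-colouring of the vertices such that every edge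
-- joins the two sides (this also excludes loops)
Bipartite : ∀ {n m} → Multigraph n m → Set
Bipartite {n} G = Σ (Fin n → Bool) λ side →
  ∀ e → side (end₁ G e) ≡ not (side (end₂ G e))

degree : ∀ {n m} → Multigraph n m → Fin n → ℕ
degree {m = m} G v = length (filter (λ e → incident? G v e Data.Bool.≟ true) (allFin m))
  where import Data.Bool

maxDegree : ∀ {n m} → Multigraph n m → ℕ
maxDegree {n} G = foldr (λ v acc → degree G v ⊔ acc) 0 (allFin n)

ProperColouring : ∀ {n m} {C : Set} → Multigraph n m → (Fin m → C) → Set
ProperColouring G c = ∀ e f v → e ≢ f → Incident G v e → Incident G v f → c e ≢ c f

-- A precolouring is a partial colouring; S = { e | pre e ≡ just _ }.
-- Proper on S:
ProperPrecolouring : ∀ {n m} {C : Set} → Multigraph n m → (Fin m → Maybe C) → Set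
ProperPrecolouring G pre = ∀ e f v a b → e ≢ f → Incident G v e → Incident G v f →
  pre e ≡ just a → pre f ≡ just b → a ≢ b

isPrecoloured : ∀ {m} {C : Set} → (Fin m → Maybe C) → Fin m → Bool
isPrecoloured pre e with pre e
... | just _  = true
... | nothing = false

precolDegree : ∀ {n m} {C : Set} → Multigraph n m → (Fin m → Maybe C) → Fin n → ℕ
precolDegree {m = m} G pre v =
  length (filter (λ e → (incident? G v e ∧ isPrecoloured pre e) Data.Bool.≟ true) (allFin m))
  where import Data.Bool

Extends : ∀ {m} {C : Set} → (Fin m → C) → (Fin m → Maybe C) → Set
Extends c pre = ∀ e a → pre e ≡ just a → c e ≡ a

{-# OPTIONS --safe #-}

-- Delete from each list the colours of the adjacent precoloured edges. With d(u) uncoloured and s(u)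
-- precoloured edges at u, every uncoloured edge uv keeps at least Δ + k − s(u) − s(v) colours, and
-- Galvin's method applies once the uncoloured edges are linearly ordered so that few edges beat uv
-- (the earlier ones at the end on one side, the later ones at the end on the other).
-- Such an order comes from König's theorem. Put D = max(1, Δ − k), keep at most D uncoloured edges at
-- each vertex, split off the ends of the others, colour the resulting graph with colours 0, …, D − 1
-- and order the edges by colour. An edge uv of colour i is beaten by at most i + (d(u) − D)⁺ edges at u
-- and D − 1 − i + (d(v) − D)⁺ at v, and (d(u) − D)⁺ + s(u) ≤ Δ − D ≤ k.
module Submission where

open import Defs
open import Algebra.Properties.CommutativeSemigroup using (interchange)
open import Data.Bool as Bool using (Bool; true; false; T; if_then_else_; _∧_)
open import Data.Bool.Properties using (T?)
open import Data.Fin using (Fin; zero; suc; toℕ; fromℕ<; combine; opposite)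
open import Data.Fin.Properties as Fin using (any?; all?; ¬∀⟶∃¬)
open import Data.List as List using (length; filter; tabulate; foldr)
open import Data.List.Membership.Propositional using (_∈_)
open import Data.List.Membership.Propositional.Properties using (∈-allFin)
open import Data.List.Relation.Unary.Any using (here; there)
open import Data.Maybe as Maybe using (Maybe; just; nothing)
open import Data.Maybe.Properties as Maybe using (just-injective)
open import Data.Nat using (ℕ; zero; suc; _+_; _∸_; _⊔_; _≤_; _≥_; _<_; z≤n; s≤s; _<?_; _≤?_)
open import Data.Nat.Induction using (<-wellFounded)
open import Data.Nat.Properties
open import Data.Product using (Σ; ∃; _×_; _,_; proj₁; proj₂)
open import Data.Sum as Sum using (_⊎_; inj₁; inj₂)
import Data.Sum.Properties as Sum
open import Data.Unit using (⊤; tt)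
open import Data.Vec.Functional using (_∷_)
open import Function using (_∘_; case_of_)
open import Induction.WellFounded using (Acc; acc)
open import Level using (0ℓ)
open import Relation.Binary.Core using (Rel)
open import Relation.Binary.Definitions as B using (tri<; tri≈; tri>)
open import Relation.Binary.PropositionalEquality
open import Relation.Nullary using (¬_; Dec; yes; no; contradiction)
open import Relation.Nullary.Decidable using (_×-dec_; _⊎-dec_; ¬?)
open import Relation.Unary using (Pred; Decidable; _⊆_; _∪_; _∩_)

private variable
  m n D : ℕ
  V W : Set
  P Q R : Pred (Fin m) 0ℓ

-- Counting

-- Recursion on `m` in place of the length of a filtered list, so that bounds go by induction over
-- `Fin m`. `length-filter-tabulate` identifies the two and so brings in `degree` and
-- `precolDegree`.
count : Decidable P → ℕ
count {zero}  P? = 0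
count {suc m} P? with P? zero
... | yes _ = suc (count (P? ∘ suc))
... | no  _ = count (P? ∘ suc)

count-tail : {P : Pred (Fin (suc m)) 0ℓ} (P? : Decidable P) → count (P? ∘ suc) ≤ count P?
count-tail P? with P? zero
... | yes _ = n≤1+n _
... | no _  = ≤-refl

count-suc-∈ : {P : Pred (Fin (suc m)) 0ℓ} (P? : Decidable P) → P zero →
              count (P? ∘ suc) < count P?
count-suc-∈ P? p with P? zero
... | yes _ = ≤-refl
... | no ¬p = contradiction p ¬p

count-suc : {P : Pred (Fin (suc m)) 0ℓ} (P? : Decidable P) → count P? ≤ suc (count (P? ∘ suc))
count-suc P? with P? zero
... | yes _ = ≤-refl
... | no _  = n≤1+n _

count-suc-∉ : {P : Pred (Fin (suc m)) 0ℓ} (P? : Decidable P) → ¬ P zero →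
              count P? ≤ count (P? ∘ suc)
count-suc-∉ P? ¬p with P? zero
... | yes p = contradiction p ¬p
... | no _  = ≤-refl

length-filter-tabulate : ∀ {A : Set} {P : Pred A 0ℓ} (P? : Decidable P) (f : Fin m → A) →
                         length (filter P? (tabulate f)) ≡ count (P? ∘ f)
length-filter-tabulate {zero}  P? f = refl
length-filter-tabulate {suc m} P? f with P? (f zero)
... | yes _ = cong suc (length-filter-tabulate P? (f ∘ suc))
... | no  _ = length-filter-tabulate P? (f ∘ suc)

count-mono : (P? : Decidable P) (Q? : Decidable Q) → P ⊆ Q → count P? ≤ count Q?
count-mono {zero}  P? Q? sub = z≤n
count-mono {suc m} P? Q? sub with P? zero | Q? zero
... | yes p | yes q = s≤s (count-mono (P? ∘ suc) (Q? ∘ suc) sub)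
... | yes p | no ¬q = contradiction (sub p) ¬q
... | no ¬p | yes q = m≤n⇒m≤1+n (count-mono (P? ∘ suc) (Q? ∘ suc) sub)
... | no ¬p | no ¬q = count-mono (P? ∘ suc) (Q? ∘ suc) sub

count-mono-< : (P? : Decidable P) (Q? : Decidable Q) → P ⊆ Q →
               ∀ {j} → Q j → ¬ P j → count P? < count Q?
count-mono-< {suc m} P? Q? sub {zero} qj ¬pj with P? zero | Q? zero
... | yes p | _     = contradiction p ¬pj
... | no ¬p | yes q = s≤s (count-mono (P? ∘ suc) (Q? ∘ suc) sub)
... | no ¬p | no ¬q = contradiction qj ¬q
count-mono-< {suc m} P? Q? sub {suc j} qj ¬pj with P? zero | Q? zero
... | yes p | yes q = s≤s (count-mono-< (P? ∘ suc) (Q? ∘ suc) sub qj ¬pj)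
... | yes p | no ¬q = contradiction (sub p) ¬q
... | no ¬p | yes q = m≤n⇒m≤1+n (count-mono-< (P? ∘ suc) (Q? ∘ suc) sub qj ¬pj)
... | no ¬p | no ¬q = count-mono-< (P? ∘ suc) (Q? ∘ suc) sub qj ¬pj

count-∪ : (P? : Decidable P) (Q? : Decidable Q) (R? : Decidable R) →
          P ⊆ Q ∪ R → count P? ≤ count Q? + count R?
count-∪ {zero}  P? Q? R? sub = z≤n
count-∪ {suc m} P? Q? R? sub
  with P? zero | Q? zero | R? zero | count-∪ (P? ∘ suc) (Q? ∘ suc) (R? ∘ suc) sub
... | no _  | yes _ | yes _ | ih = m≤n⇒m≤1+n (≤-trans ih (+-monoʳ-≤ _ (n≤1+n _)))
... | no _  | yes _ | no _  | ih = m≤n⇒m≤1+n ih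
... | no _  | no _  | yes _ | ih = ≤-trans ih (+-monoʳ-≤ _ (n≤1+n _))
... | no _  | no _  | no _  | ih = ih
... | yes _ | yes _ | yes _ | ih = s≤s (≤-trans ih (+-monoʳ-≤ _ (n≤1+n _)))
... | yes _ | yes _ | no _  | ih = s≤s ih
... | yes _ | no _  | yes _ | ih = ≤-trans (s≤s ih) (≤-reflexive (sym (+-suc _ _)))
... | yes p | no ¬q | no ¬r | ih with sub p
...   | inj₁ q = contradiction q ¬q
...   | inj₂ r = contradiction r ¬r

count-disjoint : (P? : Decidable P) (Q? : Decidable Q) (R? : Decidable R) →
                 Q ⊆ P → R ⊆ P → (∀ {i} → Q i → ¬ R i) → count Q? + count R? ≤ count P?
count-disjoint {zero}  P? Q? R? q⊆p r⊆p dis = z≤n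
count-disjoint {suc m} P? Q? R? q⊆p r⊆p dis
  with P? zero | Q? zero | R? zero
     | count-disjoint (P? ∘ suc) (Q? ∘ suc) (R? ∘ suc) q⊆p r⊆p dis
... | _     | yes q | yes r | ih = contradiction r (dis q)
... | yes _ | yes _ | no _  | ih = s≤s ih
... | yes _ | no _  | yes _ | ih = ≤-trans (≤-reflexive (+-suc _ _)) (s≤s ih)
... | yes _ | no _  | no _  | ih = m≤n⇒m≤1+n ih
... | no ¬p | yes q | no _  | ih = contradiction (q⊆p q) ¬p
... | no ¬p | no _  | yes r | ih = contradiction (r⊆p r) ¬p
... | no _  | no _  | no _  | ih = ih

count-inj : (P? : Decidable P) (Q? : Decidable Q) (w : ∀ {i} → P i → Fin n) →
            (∀ {i} (x : P i) → Q (w x)) →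
            (∀ {i j} (x : P i) (y : P j) → w x ≡ w y → i ≡ j) →
            count P? ≤ count Q?
count-inj {zero}  P? Q? w wQ inj = z≤n
count-inj {suc m} P? Q? w wQ inj with P? zero
... | no _   = count-inj (P? ∘ suc) Q? w wQ (λ x y eq → Fin.suc-injective (inj x y eq))
-- The image `w p₀` is removed from `Q`: by injectivity the other members of `P` still land in what
-- remains, and the removal lowers the count by at least one.
... | yes p₀ = ≤-trans
  (s≤s (count-inj (P? ∘ suc) Q∖w? w
    (λ x → wQ x , λ eq → contradiction (inj x p₀ eq) λ ())
    (λ x y eq → Fin.suc-injective (inj x y eq))))
  (count-mono-< Q∖w? Q? proj₁ (wQ p₀) (λ q → proj₂ q refl))
  where Q∖w? = λ j → Q? j ×-dec ¬? (j Fin.≟ w p₀)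

count-all : count {m} (λ _ → yes tt) ≡ m
count-all {zero}  = refl
count-all {suc m} = cong suc (count-all {m})

-- Greedy choice of the first `D` members of `P`. Truncated subtraction makes the last bound say
-- that nothing is left over when `P` has at most `D` members.
select : (P? : Decidable P) (D : ℕ) →
         Σ (Fin m → Bool) λ q → T ∘ q ⊆ P
           × count (T? ∘ q) ≤ D
           × count (λ i → P? i ×-dec ¬? (T? (q i))) ≤ count P? ∸ D
select {m} P? zero =
  (λ _ → false) , (λ ()) , none m , count-mono (λ i → P? i ×-dec ¬? (T? false)) P? proj₁
  where
  none : ∀ m → count {m} (λ _ → T? false) ≤ 0
  none zero    = z≤n
  none (suc m) = none m
select {zero}  P? (suc D) = (λ ()) , (λ { {()} }) , z≤n , z≤n
select {suc m} {P} P? (suc D) with P? zero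
... | no ¬p = let q , q⊆ , q≤ , rest = select (P? ∘ suc) (suc D) in
  false ∷ q , (λ { {suc i} → q⊆ }) , q≤ , rest
... | yes p = let q , q⊆ , q≤ , rest = select (P? ∘ suc) D in
  true ∷ q , (λ { {zero} _ → p ; {suc i} → q⊆ }) , s≤s q≤ , rest

-- Closures of finite relations

Closure : (I : Pred (Fin m) 0ℓ) (S : Rel (Fin m) 0ℓ) → Pred (Fin m) 0ℓ → Set
Closure I S C = Decidable C × I ⊆ C
  × (∀ {e f} → C e → S e f → C f)
  × (∀ {f} → C f → I f ⊎ ∃ λ e → C e × S e f)

-- Successors are added one at a time; the number of elements still outside decreases. The last
-- component of `Closure`, an immediate predecessor for every member that is not initial, stands in
-- for a walk from `I`.
closure : {I : Pred (Fin m) 0ℓ} {S : Rel (Fin m) 0ℓ} → Decidable I → B.Decidable S →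
          Σ (Pred (Fin m) 0ℓ) (Closure I S)
closure {m} {I} {S} I? S? = grow I? (λ x → x) inj₁ (<-wellFounded _)
  where
  grow : {C : Pred (Fin m) 0ℓ} (C? : Decidable C) → I ⊆ C →
         (∀ {f} → C f → I f ⊎ ∃ λ e → C e × S e f) →
         Acc _<_ (count (λ f → ¬? (C? f))) → Σ (Pred (Fin m) 0ℓ) (Closure I S)
  grow {C} C? I⊆C back (acc rs)
    with any? (λ f → ¬? (C? f) ×-dec any? (λ e → C? e ×-dec S? e f))
  ... | no ¬ext = C , C? , I⊆C , closed , back
    where
    closed : ∀ {e f} → C e → S e f → C f
    closed {e} {f} ce sef with C? f
    ... | yes cf = cf
    ... | no ¬cf = contradiction (f , ¬cf , e , ce , sef) ¬ext
  ... | yes (f , ¬cf , e , ce , sef) =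
    grow C'? (λ i → inj₁ (I⊆C i)) back'
      (rs (count-mono-< (λ g → ¬? (C'? g)) (λ g → ¬? (C? g))
            (λ ¬c' cg → ¬c' (inj₁ cg)) ¬cf (λ ¬c' → ¬c' (inj₂ refl))))
    where
    C' : Pred (Fin m) 0ℓ
    C' g = C g ⊎ g ≡ f
    C'? : Decidable C'
    C'? g = C? g ⊎-dec (g Fin.≟ f)
    back' : ∀ {g} → C' g → I g ⊎ ∃ λ e → C' e × S e g
    back' (inj₁ cg)   = Sum.map₂ (λ (e , ce , s) → e , inj₁ ce , s) (back cg)
    back' (inj₂ refl) = inj₂ (e , inj₁ ce , sef)

-- König's edge-colouring theorem

-- Pigeonhole: if every colour occurred on `P`, choosing an edge of each colour would inject the `D`
-- colours into `P`, because an edge has only one colour.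
missing : {P : Pred (Fin m) 0ℓ} (P? : Decidable P) (c : Fin m → Fin D) → count P? < D →
          ∃ λ α → ∀ {e} → P e → c e ≢ α
missing {D = D} {P = P} P? c <D with all? (λ α → any? (λ e → P? e ×-dec (c e Fin.≟ α)))
... | no ¬all = let α , ¬α = ¬∀⟶∃¬ D _ (λ α → any? (λ e → P? e ×-dec (c e Fin.≟ α))) ¬all in
  α , λ p eq → ¬α (_ , p , eq)
... | yes all = contradiction <D (≤⇒≯ (subst (_≤ count P?) count-all
  (count-inj (λ _ → yes tt) P? (λ {α} _ → proj₁ (all α)) (λ {α} _ → proj₁ (proj₂ (all α)))
    λ {α} {β} _ _ eq → trans (sym (proj₂ (proj₂ (all α)))) (trans (cong c eq) (proj₂ (proj₂ (all β)))))))

-- Edge e joins the vertex l e of one side to the vertex r e of the other.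
Proper : (Fin m → V) → (Fin m → W) → (Fin m → Fin D) → Set
Proper l r c = ∀ {e f} → l e ≡ l f ⊎ r e ≡ r f → c e ≡ c f → e ≡ f

-- C is the α-β-component of v: a walk from v enters the l-side through colour α only,
-- hence never reaches u.
kempe : (l : Fin m → V) (r : Fin m → W) → B.DecidableEquality V → B.DecidableEquality W →
        (c : Fin m → Fin D) → Proper l r c →
        ∀ {u v α β} → (∀ {e} → l e ≡ u → c e ≢ α) → (∀ {e} → r e ≡ v → c e ≢ β) →
        Σ (Fin m → Fin D) λ c′ → Proper l r c′ × (∀ {e} → l e ≡ u ⊎ r e ≡ v → c′ e ≢ α)
kempe {m} {D = D} l r _≟ᵛ_ _≟ʷ_ c prop {u} {v} {α} {β} u-α v-β with α Fin.≟ β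
... | yes refl = c , prop , λ { (inj₁ eq) → u-α eq ; (inj₂ eq) → v-β eq }
... | no α≢β = c′ , proper′ , missing′
  where
  Step : Rel (Fin m) 0ℓ
  Step e f = (c e ≡ α × c f ≡ β × l e ≡ l f) ⊎ (c e ≡ β × c f ≡ α × r e ≡ r f)
  cl = closure {S = Step}
    (λ e → (r e ≟ʷ v) ×-dec (c e Fin.≟ α))
    (λ e f → ((c e Fin.≟ α) ×-dec (c f Fin.≟ β) ×-dec (l e ≟ᵛ l f))
        ⊎-dec ((c e Fin.≟ β) ×-dec (c f Fin.≟ α) ×-dec (r e ≟ʷ r f)))
  C : Pred (Fin m) 0ℓ
  C = proj₁ cl
  C? = proj₁ (proj₂ cl)
  start = proj₁ (proj₂ (proj₂ cl))
  closed = proj₁ (proj₂ (proj₂ (proj₂ cl)))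
  back = proj₂ (proj₂ (proj₂ (proj₂ cl)))

  αβ : ∀ {e} → C e → c e ≡ α ⊎ c e ≡ β
  αβ ce with back ce
  ... | inj₁ (_ , eq) = inj₁ eq
  ... | inj₂ (_ , _ , inj₁ (_ , eq , _)) = inj₂ eq
  ... | inj₂ (_ , _ , inj₂ (_ , eq , _)) = inj₁ eq

  back-α : ∀ {e} → C e → c e ≡ α → r e ≡ v ⊎ ∃ λ f → C f × c f ≡ β × r f ≡ r e
  back-α ce eα with back ce
  ... | inj₁ (eq , _) = inj₁ eq
  ... | inj₂ (f , cf , inj₁ (_ , eβ , _)) = contradiction (trans (sym eα) eβ) α≢β
  ... | inj₂ (f , cf , inj₂ (fβ , _ , rr)) = inj₂ (f , cf , fβ , rr)

  back-β : ∀ {e} → C e → c e ≡ β → ∃ λ f → C f × c f ≡ α × l f ≡ l e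
  back-β ce eβ with back ce
  ... | inj₁ (_ , eα) = contradiction (trans (sym eα) eβ) α≢β
  ... | inj₂ (f , cf , inj₁ (fα , _ , ll)) = f , cf , fα , ll
  ... | inj₂ (f , cf , inj₂ (_ , eα , _)) = contradiction (trans (sym eα) eβ) α≢β

  -- `Step` is directed, from α to β at l-ends and from β to α at r-ends. Against this direction,
  -- the predecessor of `e` at the shared end has the colour of `f` and so is `f` by properness;
  -- only an α-edge at `v` may lack a predecessor, and `v` has no β-edge.
  component : ∀ {e f} → C e → c f ≡ α ⊎ c f ≡ β → l e ≡ l f ⊎ r e ≡ r f → C f
  component ce f∈ touch with αβ ce
  component ce (inj₁ fα) touch | inj₁ eα = subst C (prop touch (trans eα (sym fα))) ce
  component ce (inj₂ fβ) touch | inj₂ eβ = subst C (prop touch (trans eβ (sym fβ))) ce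
  component ce (inj₂ fβ) (inj₁ ll) | inj₁ eα = closed ce (inj₁ (eα , fβ , ll))
  component ce (inj₁ fα) (inj₂ rr) | inj₂ eβ = closed ce (inj₂ (eβ , fα , rr))
  component ce (inj₂ fβ) (inj₂ rr) | inj₁ eα with back-α ce eα
  ... | inj₁ re≡v = contradiction fβ (v-β (trans (sym rr) re≡v))
  ... | inj₂ (g , cg , gβ , rg) = subst C (prop (inj₂ (trans rg rr)) (trans gβ (sym fβ))) cg
  component ce (inj₁ fα) (inj₁ ll) | inj₂ eβ with back-β ce eβ
  ... | g , cg , gα , lg = subst C (prop (inj₁ (trans lg ll)) (trans gα (sym fα))) cg

  ¬Cu : ∀ {e} → C e → l e ≢ u
  ¬Cu ce eq with αβ ce
  ... | inj₁ eα = u-α eq eα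
  ... | inj₂ eβ with back-β ce eβ
  ...   | _ , _ , gα , lg = u-α (trans lg eq) gα

  c′ : Fin m → Fin D
  c′ e with C? e | c e Fin.≟ α
  ... | no _  | _     = c e
  ... | yes _ | yes _ = β
  ... | yes _ | no _  = α

  -- The case split of `c′` as a view, so that facts about the new colouring follow by matching on
  -- what happened to each edge.
  data Swap (e : Fin m) : Fin D → Set where
    outside : ¬ C e → Swap e (c e)
    α↦β     : C e → c e ≡ α → Swap e β
    β↦α     : C e → c e ≡ β → Swap e α

  swap : ∀ e → Swap e (c′ e)
  swap e with C? e | c e Fin.≟ α
  ... | no ¬ce | _ = outside ¬ce
  ... | yes ce | yes eα = α↦β ce eα
  ... | yes ce | no e≢α with αβ ce
  ...   | inj₁ eα = contradiction eα e≢α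
  ...   | inj₂ eβ = β↦α ce eβ

  proper-swap : ∀ {e f x y} → Swap e x → Swap f y → l e ≡ l f ⊎ r e ≡ r f → x ≡ y → e ≡ f
  proper-swap (outside _)  (outside _)  t eq = prop t eq
  proper-swap (α↦β _ eα)   (α↦β _ fα)   t eq = prop t (trans eα (sym fα))
  proper-swap (β↦α _ eβ)   (β↦α _ fβ)   t eq = prop t (trans eβ (sym fβ))
  proper-swap (α↦β _ _)    (β↦α _ _)    t eq = contradiction (sym eq) α≢β
  proper-swap (β↦α _ _)    (α↦β _ _)    t eq = contradiction eq α≢β
  -- In the mixed cases the unchanged edge has colour α or β and touches a member of `C`, so
  -- `component` would put it into `C`.
  proper-swap (outside ¬e) (α↦β cf _)   t eq = contradiction (component cf (inj₂ eq) (Sum.map sym sym t)) ¬e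
  proper-swap (outside ¬e) (β↦α cf _)   t eq = contradiction (component cf (inj₁ eq) (Sum.map sym sym t)) ¬e
  proper-swap (α↦β ce _)   (outside ¬f) t eq = contradiction (component ce (inj₂ (sym eq)) t) ¬f
  proper-swap (β↦α ce _)   (outside ¬f) t eq = contradiction (component ce (inj₁ (sym eq)) t) ¬f

  proper′ : Proper l r c′
  proper′ {e} {f} = proper-swap (swap e) (swap f)

  missing-swap : ∀ {e x} → Swap e x → l e ≡ u ⊎ r e ≡ v → x ≢ α
  missing-swap (outside ¬e) (inj₁ eq) = u-α eq
  missing-swap (outside ¬e) (inj₂ eq) eα = ¬e (start (eq , eα))
  missing-swap (α↦β _ _)    _         β≡α = α≢β (sym β≡α)
  missing-swap (β↦α ce _)   (inj₁ eq) _ = ¬Cu ce eq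
  missing-swap (β↦α _ eβ)   (inj₂ eq) _ = v-β eq eβ

  missing′ : ∀ {e} → l e ≡ u ⊎ r e ≡ v → c′ e ≢ α
  missing′ {e} = missing-swap (swap e)

-- Induction on the edges. Without edge `zero` each of its ends has fewer than `D` edges and so
-- misses a colour; a Kempe swap makes one colour missing at both, and `zero` receives it. The
-- degree bounds are indexed by edges, so the vertex types need only decidable equality.
koenig : (l : Fin m → V) (r : Fin m → W)
         (_≟ᵛ_ : B.DecidableEquality V) (_≟ʷ_ : B.DecidableEquality W) →
         (∀ e → count (λ f → l f ≟ᵛ l e) ≤ D) → (∀ e → count (λ f → r f ≟ʷ r e) ≤ D) →
         Σ (Fin m → Fin D) (Proper l r)
koenig {zero}  l r _≟ᵛ_ _≟ʷ_ l≤ r≤ = (λ ()) , λ { {()} }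
koenig {suc m} {D = D} l r _≟ᵛ_ _≟ʷ_ l≤ r≤ =
  let c , prop = koenig (l ∘ suc) (r ∘ suc) _≟ᵛ_ _≟ʷ_
        (λ e → ≤-trans (count-tail (λ f → l f ≟ᵛ l (suc e))) (l≤ (suc e)))
        (λ e → ≤-trans (count-tail (λ f → r f ≟ʷ r (suc e))) (r≤ (suc e)))
      α , u-α = missing (λ f → l (suc f) ≟ᵛ l zero) c (≤-trans (count-suc-∈ (λ f → l f ≟ᵛ l zero) refl) (l≤ zero))
      β , v-β = missing (λ f → r (suc f) ≟ʷ r zero) c (≤-trans (count-suc-∈ (λ f → r f ≟ʷ r zero) refl) (r≤ zero))
      c′ , prop′ , miss = kempe (l ∘ suc) (r ∘ suc) _≟ᵛ_ _≟ʷ_ c prop u-α v-β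
  in α ∷ c′ , λ
    { {zero}  {zero}  t eq → refl
    ; {zero}  {suc f} t eq → contradiction (sym eq) (miss (Sum.map sym sym t))
    ; {suc e} {zero}  t eq → contradiction eq (miss t)
    ; {suc e} {suc f} t eq → cong suc (prop′ t eq) }

-- Galvin's theorem

module Preferences {m} (l : Fin m → V) (r : Fin m → W)
  (_≟ᵛ_ : B.DecidableEquality V) (_≟ʷ_ : B.DecidableEquality W)
  (p : Fin m → ℕ) (p-injective : ∀ {e f} → p e ≡ p f → e ≡ f) where

  Touch : Rel (Fin m) 0ℓ
  Touch e f = l e ≡ l f ⊎ r e ≡ r f

  -- Vertices on the l-side prefer small values of p, those on the r-side large values.
  Beats : Rel (Fin m) 0ℓ
  Beats f e = (l f ≡ l e × p f < p e) ⊎ (r f ≡ r e × p e < p f)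

  -- A stable matching among the edges of `E` for the preferences given by `p`.
  Kernel : Pred (Fin m) 0ℓ → Pred (Fin m) 0ℓ → Set
  Kernel E M = Decidable M × M ⊆ E
    × (∀ {e f} → M e → M f → Touch e f → e ≡ f)
    × (∀ {e} → E e → ¬ M e → ∃ λ f → M f × Beats f e)

  -- Deferred acceptance in the manner of Gale and Shapley: each l-vertex proposes its best edge. If
  -- no two proposals meet on the r-side they form the kernel; otherwise an edge rejected at its
  -- r-end is deleted and the search starts again.
  kernel : {E : Pred (Fin m) 0ℓ} (E? : Decidable E) → Acc _<_ (count E?) →
           Σ (Pred (Fin m) 0ℓ) (Kernel E)
  kernel {E} E? (acc rs) = result
    where
    Better : Rel (Fin m) 0ℓ
    Better f e = E f × l f ≡ l e × p f < p e
    better? : ∀ e → Dec (∃ λ f → Better f e)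
    better? e = any? (λ f → E? f ×-dec (l f ≟ᵛ l e) ×-dec (p f <? p e))
    Best : Pred (Fin m) 0ℓ
    Best e = E e × ¬ ∃ λ f → Better f e
    best? : Decidable Best
    best? e = E? e ×-dec ¬? (better? e)

    best-of : ∀ {e} → E e → Acc _<_ (p e) → Best e ⊎ ∃ λ f → Best f × l f ≡ l e × p f < p e
    best-of {e} ee (acc rs) with better? e
    ... | no ¬b = inj₁ (ee , ¬b)
    ... | yes (f , ef , lf , f<e) with best-of ef (rs f<e)
    ...   | inj₁ bf = inj₂ (f , bf , lf , f<e)
    ...   | inj₂ (g , bg , lg , g<f) = inj₂ (g , bg , trans lg lf , <-trans g<f f<e)

    result : Σ (Pred (Fin m) 0ℓ) (Kernel E)
    result with any? (λ e → any? (λ f → best? e ×-dec best? f ×-dec (r e ≟ʷ r f) ×-dec (p e <? p f)))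
    ... | no ¬clash = Best , best? , proj₁ , indep , beaten
      where
      indep : ∀ {e f} → Best e → Best f → Touch e f → e ≡ f
      indep {e} {f} be bf t with <-cmp (p e) (p f) | t
      ... | tri≈ _ eq _ | _ = p-injective eq
      ... | tri< e<f _ _ | inj₁ ll = contradiction (e , proj₁ be , ll , e<f) (proj₂ bf)
      ... | tri> _ _ f<e | inj₁ ll = contradiction (f , proj₁ bf , sym ll , f<e) (proj₂ be)
      ... | tri< e<f _ _ | inj₂ rr = contradiction (e , f , be , bf , rr , e<f) ¬clash
      ... | tri> _ _ f<e | inj₂ rr = contradiction (f , e , bf , be , sym rr , f<e) ¬clash
      beaten : ∀ {e} → E e → ¬ Best e → ∃ λ f → Best f × Beats f e
      beaten ee ¬be with best-of ee (<-wellFounded _)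
      ... | inj₁ be = contradiction be ¬be
      ... | inj₂ (f , bf , lf , f<e) = f , bf , inj₁ (lf , f<e)
    -- No kernel needs e: whatever beats f at its r-end beats e there, and f is unbeaten at its l-end.
    ... | yes (e , f , be , bf , rr , e<f) =
      let M , M? , M⊆ , indep , beaten =
            kernel {E = E ∩ (_≢ e)} (λ g → E? g ×-dec ¬? (g Fin.≟ e))
              (rs (count-mono-< (λ g → E? g ×-dec ¬? (g Fin.≟ e)) E? proj₁ (proj₁ be) (λ q → proj₂ q refl)))
          beaten-e : ∃ λ g → M g × Beats g e
          beaten-e = case M? f of λ where
            (yes mf) → f , mf , inj₂ (sym rr , e<f)
            (no ¬mf) → case beaten (proj₁ bf , λ { refl → <-irrefl refl e<f }) ¬mf of λ where
              (g , mg , inj₁ (lg , g<f)) → contradiction (g , proj₁ (M⊆ mg) , lg , g<f) (proj₂ bf)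
              (g , mg , inj₂ (rg , f<g)) → g , mg , inj₂ (trans rg (sym rr) , <-trans e<f f<g)
      in M , M? , (λ mg → proj₁ (M⊆ mg)) , indep , λ {g} eg ¬mg → case g Fin.≟ e of λ where
           (yes refl) → beaten-e
           (no g≢e)   → beaten (eg , g≢e) ¬mg

  -- The two conditions on `p` exclude each other, so the sum of the ranks is the number of edges of
  -- `U` that beat `e`; parallel edges are not counted twice.
  rankˡ rankʳ : {U : Pred (Fin m) 0ℓ} → Decidable U → Fin m → ℕ
  rankˡ U? e = count (λ f → U? f ×-dec (l f ≟ᵛ l e) ×-dec (p f <? p e))
  rankʳ U? e = count (λ f → U? f ×-dec (r f ≟ʷ r e) ×-dec (p e <? p f))

  -- Values in `Maybe`, since an empty palette has no default colour for the edges outside `U`.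
  ListColouring : ∀ {K} → Pred (Fin m) 0ℓ → (Fin m → Pred (Fin K) 0ℓ) → (Fin m → Maybe (Fin K)) → Set
  ListColouring U L c = (∀ {e} → U e → ∃ λ α → L e α × c e ≡ just α)
    × (∀ {e f} → U e → U f → Touch e f → c e ≡ c f → e ≡ f)

  -- The kernel of the edges whose lists contain the first colour receives that colour; every other
  -- such edge loses one colour from its list, and one of the edges that beat it.
  galvin : ∀ {K} {U : Pred (Fin m) 0ℓ} (U? : Decidable U)
           {L : Fin m → Pred (Fin K) 0ℓ} (L? : ∀ e → Decidable (L e)) →
           (∀ {e} → U e → rankˡ U? e + rankʳ U? e < count (L? e)) →
           Σ (Fin m → Maybe (Fin K)) (ListColouring U L)
  -- With no colours all lists are empty, and the strict bound forces `U` to be empty.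
  galvin {zero} U? L? short = (λ _ → nothing) , (λ u → contradiction (short u) λ ()) ,
    λ u → contradiction (short u) λ ()
  galvin {suc K} {U} U? {L} L? short
    with kernel {E = λ e → U e × L e zero} (λ e → U? e ×-dec L? e zero) (<-wellFounded _)
  ... | M , M? , M⊆ , indep , beaten
    with galvin {U = λ e → U e × ¬ M e} (λ e → U? e ×-dec ¬? (M? e)) (λ e α → L? e (suc α)) short′
    where
    U′? : Decidable (λ e → U e × ¬ M e)
    U′? e = U? e ×-dec ¬? (M? e)
    rankˡ-mono : ∀ e → rankˡ U′? e ≤ rankˡ U? e
    rankˡ-mono e = count-mono _ (λ f → U? f ×-dec (l f ≟ᵛ l e) ×-dec (p f <? p e))
      λ ((u , _) , x) → u , x
    rankʳ-mono : ∀ e → rankʳ U′? e ≤ rankʳ U? e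
    rankʳ-mono e = count-mono _ (λ f → U? f ×-dec (r f ≟ʷ r e) ×-dec (p e <? p f))
      λ ((u , _) , x) → u , x
    rank-< : ∀ {e} → (∃ λ f → M f × Beats f e) → rankˡ U′? e + rankʳ U′? e < rankˡ U? e + rankʳ U? e
    rank-< {e} (f , mf , inj₁ x) = +-mono-<-≤
      (count-mono-< _ (λ f → U? f ×-dec (l f ≟ᵛ l e) ×-dec (p f <? p e))
        (λ ((u , _) , x) → u , x) (proj₁ (M⊆ mf) , x) (λ ((_ , ¬mf) , _) → ¬mf mf))
      (rankʳ-mono e)
    rank-< {e} (f , mf , inj₂ x) = +-mono-≤-<
      (rankˡ-mono e)
      (count-mono-< _ (λ f → U? f ×-dec (r f ≟ʷ r e) ×-dec (p e <? p f))
        (λ ((u , _) , x) → u , x) (proj₁ (M⊆ mf) , x) (λ ((_ , ¬mf) , _) → ¬mf mf))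
    short′ : ∀ {e} → U e × ¬ M e → rankˡ U′? e + rankʳ U′? e < count (L? e ∘ suc)
    short′ {e} (u , ¬me) with L? e zero
    ... | yes l₀ = <-≤-trans (rank-< (beaten (u , l₀) ¬me))
                     (≤-pred (≤-trans (short u) (count-suc (L? e))))
    ... | no ¬l₀ = ≤-<-trans (+-mono-≤ (rankˡ-mono e) (rankʳ-mono e))
                     (≤-trans (short u) (count-suc-∉ (L? e) ¬l₀))
  ... | c , listed , proper = c′ , listed′ , proper′
    where
    c′ : Fin m → Maybe (Fin (suc K))
    c′ e with M? e
    ... | yes _ = just zero
    ... | no _  = Maybe.map suc (c e)
    listed′ : ∀ {e} → U e → ∃ λ α → L e α × c′ e ≡ just α
    listed′ {e} u with M? e
    ... | yes me = zero , proj₂ (M⊆ me) , refl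
    ... | no ¬me with listed (u , ¬me)
    ...   | α , lα , eq rewrite eq = suc α , lα , refl
    proper′ : ∀ {e f} → U e → U f → Touch e f → c′ e ≡ c′ f → e ≡ f
    proper′ {e} {f} ue uf t eq with M? e | M? f
    ... | yes me | yes mf = indep me mf t
    ... | yes me | no ¬mf with listed (uf , ¬mf)
    ...   | _ , _ , cf rewrite cf = contradiction (just-injective eq) λ ()
    proper′ {e} {f} ue uf t eq | no ¬me | yes mf with listed (ue , ¬me)
    ...   | _ , _ , ce rewrite ce = contradiction (just-injective eq) λ ()
    proper′ {e} {f} ue uf t eq | no ¬me | no ¬mf
      with listed (ue , ¬me) | listed (uf , ¬mf) | proper (ue , ¬me) (uf , ¬mf) t
    ...   | _ , _ , ce | _ , _ , cf | imp rewrite ce | cf =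
      imp (cong just (Fin.suc-injective (just-injective eq)))

-- Splitting vertices and ranking edges by colour

_≟ˢ_ : B.DecidableEquality (Fin n ⊎ Fin m)
_≟ˢ_ = Sum.≡-dec Fin._≟_ Fin._≟_

degreeIn : {U : Pred (Fin m) 0ℓ} → Decidable U → (Fin m → Fin n) → Fin n → ℕ
degreeIn U? l v = count (λ e → U? e ×-dec (l e Fin.≟ v))

-- Every vertex keeps at most D + 1 of its edges in U; each other edge gets an end of its own.
module Split {m n} {U : Pred (Fin m) 0ℓ} (U? : Decidable U) (l : Fin m → Fin n) (D : ℕ) where

  kept = λ v → select (λ e → U? e ×-dec (l e Fin.≟ v)) (suc D)

  Kept : Fin n → Pred (Fin m) 0ℓ
  Kept v e = T (proj₁ (kept v) e)

  Kept? : ∀ v → Decidable (Kept v)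
  Kept? v e = T? (proj₁ (kept v) e)

  split : Fin m → Fin n ⊎ Fin m
  split e with Kept? (l e) e
  ... | yes _ = inj₁ (l e)
  ... | no _  = inj₂ e

  split-kept : ∀ {v e} → Kept v e → split e ≡ inj₁ v
  split-kept {v} {e} k with proj₁ (proj₂ (kept v)) k
  ... | _ , refl with Kept? (l e) e
  ...   | yes _ = refl
  ...   | no ¬k = contradiction k ¬k

  split≡inj₁ : ∀ {v} e → split e ≡ inj₁ v → Kept v e
  split≡inj₁ e eq with Kept? (l e) e
  split≡inj₁ e refl | yes k = k

  split≡inj₂ : ∀ {f} e → split e ≡ inj₂ f → e ≡ f
  split≡inj₂ e eq with Kept? (l e) e
  split≡inj₂ e refl | no _ = refl

  split-degree : ∀ e → count (λ f → split f ≟ˢ split e) ≤ suc D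
  split-degree e with split e
  ... | inj₁ v = ≤-trans (count-mono (λ f → split f ≟ˢ inj₁ v) (Kept? v) (split≡inj₁ _))
                   (proj₁ (proj₂ (proj₂ (kept v))))
  -- A split-off end belongs to a single edge, and one is within the cap because the cap is a
  -- successor.
  ... | inj₂ g = ≤-trans
    (count-inj {Q = λ (_ : Fin 1) → ⊤} (λ f → split f ≟ˢ inj₂ g) (λ _ → yes tt) (λ _ → zero) (λ _ → tt)
      λ {i} {j} x y _ → trans (split≡inj₂ i x) (sym (split≡inj₂ j y)))
    (s≤s z≤n)

  -- Kept edges at one vertex have distinct colours, so at most `suc (toℕ (c e))` of them have a
  -- colour up to that of `e`; the edges not kept are bounded by the excess degree. As `e` itself
  -- meets the three conditions but is not in `B`, one is saved.
  rank-bound : (c : Fin m → Fin (suc D)) → (∀ {e f} → split e ≡ split f → c e ≡ c f → e ≡ f) →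
               ∀ {e} → U e → {B : Pred (Fin m) 0ℓ} (B? : Decidable B) →
               (∀ {f} → B f → U f × l f ≡ l e × toℕ (c f) ≤ toℕ (c e)) → ¬ B e →
               count B? ≤ toℕ (c e) + (degreeIn U? l (l e) ∸ suc D)
  rank-bound c inj {e} ue {B} B? B⊆ ¬be = ≤-pred (begin-strict
    count B?                                    <⟨ count-mono-< B? A? B⊆ (ue , refl , ≤-refl) ¬be ⟩
    count A?                                    ≤⟨ count-∪ A? low? rest? cover ⟩
    count low? + count rest?                    ≤⟨ +-mono-≤ low≤ (proj₂ (proj₂ (proj₂ (kept v)))) ⟩
    suc (toℕ (c e)) + (degreeIn U? l v ∸ suc D) ∎)
    where
    open ≤-Reasoning
    v = l e
    A? : Decidable (λ f → U f × l f ≡ v × toℕ (c f) ≤ toℕ (c e))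
    A? f = U? f ×-dec (l f Fin.≟ v) ×-dec (toℕ (c f) ≤? toℕ (c e))
    low? : Decidable (λ f → Kept v f × toℕ (c f) ≤ toℕ (c e))
    low? f = Kept? v f ×-dec (toℕ (c f) ≤? toℕ (c e))
    rest? : Decidable (λ f → (U f × l f ≡ v) × ¬ Kept v f)
    rest? f = (U? f ×-dec (l f Fin.≟ v)) ×-dec ¬? (Kept? v f)
    cover : ∀ {f} → U f × l f ≡ v × toℕ (c f) ≤ toℕ (c e) →
            (Kept v f × toℕ (c f) ≤ toℕ (c e)) ⊎ ((U f × l f ≡ v) × ¬ Kept v f)
    cover {f} (u , eq , le) with Kept? v f
    ... | yes k = inj₁ (k , le)
    ... | no ¬k = inj₂ ((u , eq) , ¬k)
    low≤ : count low? ≤ suc (toℕ (c e))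
    low≤ = subst (count low? ≤_) count-all
      (count-inj low? (λ _ → yes tt) (λ (_ , le) → fromℕ< (s≤s le)) (λ _ → tt)
        λ (k , le) (k′ , le′) eq → inj (trans (split-kept k) (sym (split-kept k′)))
          (Fin.toℕ-injective (trans (sym (Fin.toℕ-fromℕ< (s≤s le)))
            (trans (cong toℕ eq) (Fin.toℕ-fromℕ< (s≤s le′))))))

-- A proper colouring of the split graph ranks the edges: the l-ends prefer small colours and the
-- r-ends large ones.
list-colour : ∀ {K} (l r : Fin m → Fin n) {U : Pred (Fin m) 0ℓ} (U? : Decidable U) (D : ℕ)
  {L : Fin m → Pred (Fin K) 0ℓ} (L? : ∀ e → Decidable (L e)) →
  (∀ {e} → U e → D + (degreeIn U? l (l e) ∸ suc D) + (degreeIn U? r (r e) ∸ suc D) < count (L? e)) →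
  Σ (Fin m → Maybe (Fin K)) λ c → (∀ {e} → U e → ∃ λ α → L e α × c e ≡ just α)
    × (∀ {e f} → U e → U f → l e ≡ l f ⊎ r e ≡ r f → c e ≡ c f → e ≡ f)
list-colour {m} l r {U} U? D L? short = galvin U? L? λ u → ≤-<-trans (ranks u) (short u)
  where
  module Sˡ = Split U? l D
  module Sʳ = Split U? r D
  k = koenig Sˡ.split Sʳ.split _≟ˢ_ _≟ˢ_ Sˡ.split-degree Sʳ.split-degree
  c = proj₁ k
  -- Lexicographic order by colour and then by edge index; the index breaks ties, which makes `p`
  -- injective.
  p : Fin m → ℕ
  p e = toℕ (combine (c e) e)
  p-inj : ∀ {e f} → p e ≡ p f → e ≡ f
  p-inj {e} {f} eq = Fin.combine-injectiveʳ (c e) e (c f) f (Fin.toℕ-injective eq)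
  p<⇒c≤ : ∀ {e f} → p e < p f → toℕ (c e) ≤ toℕ (c f)
  p<⇒c≤ {e} {f} lt = ≮⇒≥ λ gt → <-asym lt (Fin.combine-monoˡ-< f e gt)
  -- Reversing the colours turns the r-side preference for large ones into one for small ones, so
  -- that `rank-bound` serves both sides.
  opposite-mono : ∀ {i j : Fin (suc D)} → toℕ i ≤ toℕ j → toℕ (opposite j) ≤ toℕ (opposite i)
  opposite-mono {i} {j} le rewrite Fin.opposite-prop i | Fin.opposite-prop j = ∸-monoʳ-≤ D le
  opposite-injective : ∀ {i j : Fin (suc D)} → opposite i ≡ opposite j → i ≡ j
  opposite-injective {i} {j} eq =
    trans (sym (Fin.opposite-involutive i)) (trans (cong opposite eq) (Fin.opposite-involutive j))
  open Preferences l r Fin._≟_ Fin._≟_ p p-inj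
  ranks : ∀ {e} → U e → rankˡ U? e + rankʳ U? e ≤
          D + (degreeIn U? l (l e) ∸ suc D) + (degreeIn U? r (r e) ∸ suc D)
  ranks {e} u = begin
    rankˡ U? e + rankʳ U? e   ≤⟨ +-mono-≤
      (Sˡ.rank-bound c (λ eq → proj₂ k (inj₁ eq)) u _
        (λ (uf , eq , lt) → uf , eq , p<⇒c≤ lt) (λ x → <-irrefl refl (proj₂ (proj₂ x))))
      (Sʳ.rank-bound (opposite ∘ c) (λ eq ceq → proj₂ k (inj₂ eq) (opposite-injective ceq)) u _
        (λ (uf , eq , lt) → uf , eq , opposite-mono (p<⇒c≤ lt)) (λ x → <-irrefl refl (proj₂ (proj₂ x)))) ⟩
    (i + x) + (j + y)         ≡⟨ interchange +-commutativeSemigroup i x j y ⟩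
    (i + j) + (x + y)         ≡⟨ cong (_+ (x + y)) i+j≡D ⟩
    D + (x + y)               ≡⟨ +-assoc D x y ⟨
    D + x + y                 ∎
    where
    open ≤-Reasoning
    i = toℕ (c e)
    j = toℕ (opposite (c e))
    x = degreeIn U? l (l e) ∸ suc D
    y = degreeIn U? r (r e) ∸ suc D
    -- `opposite` sends colour `i` to `D ∸ i`, so the contributions of the colour at the two ends
    -- have the same sum for every edge.
    i+j≡D : i + j ≡ D
    i+j≡D = trans (cong (i +_) (Fin.opposite-prop (c e))) (m+[n∸m]≡n (Fin.toℕ≤pred[n] (c e)))

-- Precolourings

≤foldr-⊔ : ∀ {A : Set} (f : A → ℕ) {v xs} → v ∈ xs → f v ≤ foldr (λ x acc → f x ⊔ acc) 0 xs
≤foldr-⊔ f {xs = x List.∷ xs} (here refl) = m≤m⊔n _ _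
≤foldr-⊔ f {xs = x List.∷ xs} (there v∈)  = ≤-trans (≤foldr-⊔ f v∈) (m≤n⊔m (f x) _)

-- Δ ∸ suc k is max(1, Δ − k) − 1.
excess+s≤ : ∀ Δ k {d s} → 1 ≤ d → d + s ≤ Δ → s ≤ k →
            (d ∸ suc (Δ ∸ suc k)) + s ≤ Δ ∸ suc (Δ ∸ suc k)
excess+s≤ Δ k {d} {s} 1≤d d+s≤Δ s≤k with suc (Δ ∸ suc k) ≤? d
... | yes D<d = begin
  (d ∸ suc (Δ ∸ suc k)) + s ≡⟨ +-∸-comm s D<d ⟨
  (d + s) ∸ suc (Δ ∸ suc k) ≤⟨ ∸-monoˡ-≤ (suc (Δ ∸ suc k)) d+s≤Δ ⟩
  Δ ∸ suc (Δ ∸ suc k)       ∎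
  where open ≤-Reasoning
... | no D≮d = begin
  (d ∸ suc (Δ ∸ suc k)) + s ≡⟨ cong (_+ s) (m≤n⇒m∸n≡0 (<⇒≤ (≰⇒> D≮d))) ⟩
  s                         ≤⟨ s≤k ⟩
  k                         ≡⟨ m∸[m∸n]≡n k≤Δ ⟨
  Δ ∸ (Δ ∸ k)               ≡⟨ cong (Δ ∸_) (+-∸-assoc 1 k<Δ) ⟩
  Δ ∸ suc (Δ ∸ suc k)       ∎
  where
  open ≤-Reasoning
  k<Δ : suc k ≤ Δ
  -- If `Δ ∸ suc k` were zero the cap would be 1, which `d` reaches. So the subtraction is not
  -- truncated, and `Δ` minus the cap is exactly `k`.
  k<Δ = <⇒≤ (m∸n≢0⇒n<m λ eq → D≮d (subst (λ x → suc x ≤ d) (sym eq) 1≤d))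
  k≤Δ = <⇒≤ k<Δ

-- Adding `sˡ + sʳ` to both sides pairs each excess with the precoloured degree at the same end.
-- Each pair is at most `A`, the cap `suc δ` plus `A` is `Δ`, and `A` is at most `k`.
count-lists : ∀ Δ k {dˡ dʳ sˡ sʳ N} → 1 ≤ dˡ → 1 ≤ dʳ → dˡ + sˡ ≤ Δ → dʳ + sʳ ≤ Δ →
              sˡ ≤ k → sʳ ≤ k → Δ + k ≤ N + (sˡ + sʳ) →
              (Δ ∸ suc k) + (dˡ ∸ suc (Δ ∸ suc k)) + (dʳ ∸ suc (Δ ∸ suc k)) < N
-- Only for `Δ` zero does the cap exceed `Δ`, and then no vertex has an uncoloured edge.
count-lists Δ@zero k 1≤dˡ _ ≤Δ _ _ _ _ = contradiction (≤-trans 1≤dˡ (m+n≤o⇒m≤o _ ≤Δ)) λ ()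
count-lists Δ@(suc Δ′) k {dˡ} {dʳ} {sˡ} {sʳ} {N} 1≤dˡ 1≤dʳ ˡ≤Δ ʳ≤Δ sˡ≤k sʳ≤k K≤ =
  +-cancelʳ-≤ (sˡ + sʳ) _ _ (begin
    suc δ + x + y + (sˡ + sʳ)     ≡⟨ cong (_+ (sˡ + sʳ)) (+-assoc (suc δ) x y) ⟩
    suc δ + (x + y) + (sˡ + sʳ)   ≡⟨ +-assoc (suc δ) (x + y) (sˡ + sʳ) ⟩
    suc δ + ((x + y) + (sˡ + sʳ)) ≡⟨ cong (suc δ +_) (interchange +-commutativeSemigroup x y sˡ sʳ) ⟩
    suc δ + ((x + sˡ) + (y + sʳ)) ≤⟨ +-monoʳ-≤ (suc δ)
      (+-mono-≤ (excess+s≤ Δ k 1≤dˡ ˡ≤Δ sˡ≤k) (excess+s≤ Δ k 1≤dʳ ʳ≤Δ sʳ≤k)) ⟩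
    suc δ + (A + A)               ≡⟨ +-assoc (suc δ) A A ⟨
    suc δ + A + A                 ≡⟨ cong (_+ A) (m+[n∸m]≡n {suc δ} {Δ} (s≤s (m∸n≤m Δ′ k))) ⟩
    Δ + A                         ≤⟨ +-monoʳ-≤ Δ (m≤n+o⇒m∸n≤o Δ′ δ (subst (Δ′ ≤_) (+-comm k δ) (m≤n+m∸n Δ′ k))) ⟩
    Δ + k                         ≤⟨ K≤ ⟩
    N + (sˡ + sʳ)                 ∎)
  where
  open ≤-Reasoning
  δ = Δ ∸ suc k
  A = Δ ∸ suc δ
  x = dˡ ∸ suc δ
  y = dʳ ∸ suc δ

degree≡count : (G : Multigraph n m) (v : Fin n) →
               degree G v ≡ count (λ e → incident? G v e Bool.≟ true)
degree≡count G v = length-filter-tabulate (λ e → incident? G v e Bool.≟ true) (λ e → e)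

precolDegree≡count : ∀ {C : Set} (G : Multigraph n m) (pre : Fin m → Maybe C) (v : Fin n) →
  precolDegree G pre v ≡ count (λ e → (incident? G v e ∧ isPrecoloured pre e) Bool.≟ true)
precolDegree≡count G pre v =
  length-filter-tabulate (λ e → (incident? G v e ∧ isPrecoloured pre e) Bool.≟ true) (λ e → e)

incident?-complete : (G : Multigraph n m) {v : Fin n} {e : Fin m} → Incident G v e → incident? G v e ≡ true
incident?-complete G {v} {e} i with end₁ G e Fin.≟ v | end₂ G e Fin.≟ v | i
... | yes _ | _     | _      = refl
... | no _  | yes _ | _      = refl
... | no ¬p | no _  | inj₁ p = contradiction p ¬p
... | no _  | no ¬p | inj₂ p = contradiction p ¬p

-- Extending the precolouring

module Extension {n m} (G : Multigraph n m) (bip : Bipartite G) (k : ℕ)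
  (pre : Fin m → Maybe (Fin (maxDegree G + k))) (pre-proper : ProperPrecolouring G pre)
  (pre≤k : ∀ v → precolDegree G pre v ≤ k) where

  Δ = maxDegree G
  K = Δ + k
  side = proj₁ bip

  -- `end₁` and `end₂` may mix the two sides. Sorting the ends by side gives the maps `end true` and
  -- `end false` that serve as `l` and `r`.
  end : Bool → Fin m → Fin n
  end b e = if side (end₁ G e) Bool.xor b then end₂ G e else end₁ G e

  side-end : ∀ b e → side (end b e) ≡ b
  side-end b e with side (end₁ G e) in eq₁ | side (end₂ G e) in eq₂ | proj₂ bip e | b
  ... | true  | false | _ | true  = eq₁
  ... | true  | false | _ | false = eq₂
  ... | false | true  | _ | true  = eq₂
  ... | false | true  | _ | false = eq₁

  end-incident : ∀ b e → Incident G (end b e) e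
  end-incident b e with side (end₁ G e) Bool.xor b
  ... | true  = inj₂ refl
  ... | false = inj₁ refl

  incident-end : ∀ {v e} → Incident G v e → end (side v) e ≡ v
  incident-end {e = e} (inj₁ refl) with side (end₁ G e)
  ... | true  = refl
  ... | false = refl
  incident-end {e = e} (inj₂ refl) with side (end₁ G e) | side (end₂ G e) | proj₂ bip e
  ... | true  | false | _ = refl
  ... | false | true  | _ = refl

  Uncoloured : Pred (Fin m) 0ℓ
  Uncoloured e = pre e ≡ nothing

  uncoloured? : Decidable Uncoloured
  uncoloured? e = Maybe.≡-dec Fin._≟_ (pre e) nothing

  Blocked : Bool → Fin m → Pred (Fin K) 0ℓ
  Blocked b e α = ∃ λ f → end b f ≡ end b e × pre f ≡ just α

  blocked? : ∀ b e → Decidable (Blocked b e)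
  blocked? b e α = any? λ f → (end b f Fin.≟ end b e) ×-dec Maybe.≡-dec Fin._≟_ (pre f) (just α)

  Available : Fin m → Pred (Fin K) 0ℓ
  Available e α = ¬ Blocked true e α × ¬ Blocked false e α

  available? : ∀ e → Decidable (Available e)
  available? e α = ¬? (blocked? true e α) ×-dec ¬? (blocked? false e α)

  precoloured-at : ∀ {b e v α} → end b e ≡ v → pre e ≡ just α →
                   incident? G v e ∧ isPrecoloured pre e ≡ true
  precoloured-at {b} {e} refl eq rewrite incident?-complete G (end-incident b e) | eq = refl

  -- Each blocked colour is sent to a precoloured edge carrying it; an edge carries one colour, so
  -- this is injective.
  count-blocked : ∀ b e → count (blocked? b e) ≤ precolDegree G pre (end b e)
  count-blocked b e = subst (count (blocked? b e) ≤_) (sym (precolDegree≡count G pre _))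
    (count-inj (blocked? b e) (λ f → (incident? G (end b e) f ∧ isPrecoloured pre f) Bool.≟ true)
      proj₁ (λ (_ , at , eq) → precoloured-at at eq)
      λ (_ , _ , eq) (_ , _ , eq′) same →
        just-injective (trans (sym eq) (trans (cong pre same) eq′)))

  K≤available : ∀ e → K ≤ count (available? e) +
                (precolDegree G pre (end true e) + precolDegree G pre (end false e))
  K≤available e = begin
    K ≡⟨ count-all ⟨
    count {K} (λ _ → yes tt)
      ≤⟨ count-∪ (λ _ → yes tt) (available? e) (λ α → blocked? true e α ⊎-dec blocked? false e α) cover ⟩
    count (available? e) + count (λ α → blocked? true e α ⊎-dec blocked? false e α)
      ≤⟨ +-monoʳ-≤ (count (available? e))
           (count-∪ (λ α → blocked? true e α ⊎-dec blocked? false e α) (blocked? true e) (blocked? false e) λ x → x) ⟩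
    count (available? e) + (count (blocked? true e) + count (blocked? false e))
      ≤⟨ +-monoʳ-≤ (count (available? e)) (+-mono-≤ (count-blocked true e) (count-blocked false e)) ⟩
    count (available? e) + (precolDegree G pre (end true e) + precolDegree G pre (end false e)) ∎
    where
    open ≤-Reasoning
    cover : ∀ {α} → ⊤ → Available e α ⊎ (Blocked true e α ⊎ Blocked false e α)
    cover {α} _ with blocked? true e α | blocked? false e α
    ... | yes b | _     = inj₂ (inj₁ b)
    ... | no _  | yes b = inj₂ (inj₂ b)
    ... | no ¬b | no ¬c = inj₁ (¬b , ¬c)

  degrees≤Δ : ∀ b v → degreeIn uncoloured? (end b) v + precolDegree G pre v ≤ Δ
  degrees≤Δ b v = begin
    degreeIn uncoloured? (end b) v + precolDegree G pre v
      ≡⟨ cong (degreeIn uncoloured? (end b) v +_) (precolDegree≡count G pre v) ⟩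
    degreeIn uncoloured? (end b) v + count S?
      ≤⟨ count-disjoint (λ e → incident? G v e Bool.≟ true)
           (λ e → uncoloured? e ×-dec (end b e Fin.≟ v)) S?
           (λ { {e} (_ , refl) → incident?-complete G (end-incident b e) })
           incident-S disjoint ⟩
    count (λ e → incident? G v e Bool.≟ true) ≡⟨ degree≡count G v ⟨
    degree G v                                ≤⟨ ≤foldr-⊔ (degree G) (∈-allFin v) ⟩
    Δ                                         ∎
    where
    open ≤-Reasoning
    S? = λ e → (incident? G v e ∧ isPrecoloured pre e) Bool.≟ true
    incident-S : ∀ {e} → incident? G v e ∧ isPrecoloured pre e ≡ true → incident? G v e ≡ true
    incident-S {e} eq with incident? G v e
    ... | true = refl
    disjoint : ∀ {e} → Uncoloured e × end b e ≡ v → ¬ (incident? G v e ∧ isPrecoloured pre e ≡ true)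
    disjoint {e} (u , _) eq with incident? G v e
    ... | true rewrite u = contradiction eq λ ()

  1≤degree : ∀ b {e} → Uncoloured e → 1 ≤ degreeIn uncoloured? (end b) (end b e)
  1≤degree b {e} u =
    count-inj {P = λ (_ : Fin 1) → ⊤} (λ _ → yes tt) (λ f → uncoloured? f ×-dec (end b f Fin.≟ end b e))
      (λ _ → e) (λ _ → u , refl) λ { {zero} {zero} _ _ _ → refl }

  abstract
    listed : Σ (Fin m → Maybe (Fin K)) λ c →
      (∀ {e} → Uncoloured e → ∃ λ α → Available e α × c e ≡ just α)
      × (∀ {e f} → Uncoloured e → Uncoloured f →
           end true e ≡ end true f ⊎ end false e ≡ end false f → c e ≡ c f → e ≡ f)
    -- The splitting keeps one edge more than this argument at each vertex, so the cap is max(1, Δ -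
    -- k).
    listed = list-colour (end true) (end false) uncoloured? (Δ ∸ suc k) available? λ {e} u →
      count-lists Δ k (1≤degree true u) (1≤degree false u) (degrees≤Δ true _) (degrees≤Δ false _)
        (pre≤k (end true e)) (pre≤k (end false e)) (K≤available e)

  new = proj₁ listed
  new-available = proj₁ (proj₂ listed)
  new-proper = proj₂ (proj₂ listed)

  -- Records where the colour of `e` comes from, so that properness splits into old and new edges.
  data Colour (e : Fin m) : Fin K → Set where
    old   : ∀ {α} → pre e ≡ just α → Colour e α
    fresh : ∀ {α} → Uncoloured e → new e ≡ just α → Available e α → Colour e α

  colour : ∀ e → ∃ (Colour e)
  colour e with pre e in eq
  ... | just α  = α , old eq
  ... | nothing with new-available eq
  ...   | α , av , is = α , fresh eq is av

  -- The common vertex is the end of both edges on its own side, so `f` blocks its colour for `e` on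
  -- that side.
  ¬available : ∀ {v e f α} → Incident G v e → Incident G v f → pre f ≡ just α → ¬ Available e α
  ¬available {v} {e} {f} ie if eq (¬t , ¬f) with side v | incident-end ie | incident-end if
  ... | true  | ee | ef = ¬t (f , trans ef (sym ee) , eq)
  ... | false | ee | ef = ¬f (f , trans ef (sym ee) , eq)

  touch : ∀ {v e f} → Incident G v e → Incident G v f → end true e ≡ end true f ⊎ end false e ≡ end false f
  touch {v} ie if with side v | incident-end ie | incident-end if
  ... | true  | ee | ef = inj₁ (trans ee (sym ef))
  ... | false | ee | ef = inj₂ (trans ee (sym ef))

  colour-proper : ∀ {v e f α β} → e ≢ f → Incident G v e → Incident G v f →
                  Colour e α → Colour f β → α ≢ β
  colour-proper e≢f ie if (old p)        (old q)        eq   = pre-proper _ _ _ _ _ e≢f ie if p q eq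
  colour-proper e≢f ie if (old p)        (fresh _ _ av) refl = ¬available if ie p av
  colour-proper e≢f ie if (fresh _ _ av) (old q)        refl = ¬available ie if q av
  colour-proper e≢f ie if (fresh u p _)  (fresh w q _)  refl =
    e≢f (new-proper u w (touch ie if) (trans p (sym q)))

  colour-extends : ∀ {e α a} → Colour e α → pre e ≡ just a → α ≡ a
  colour-extends (old p)       eq = just-injective (trans (sym p) eq)
  colour-extends (fresh u _ _) eq = contradiction (trans (sym u) eq) λ ()

theorem2p1 : ∀ {n m} (G : Multigraph n m) → Bipartite G →
    (k : ℕ) → k ≥ 1 →
    (pre : Fin m → Maybe (Fin (maxDegree G + k))) →
    ProperPrecolouring G pre →
    (∀ v → precolDegree G pre v ≤ k) →
    Σ (Fin m → Fin (maxDegree G + k)) λ c → ProperColouring G c × Extends c pre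
theorem2p1 G bip k _ pre pre-proper pre≤k =
  (λ e → proj₁ (colour e)) ,
  (λ e f v e≢f ie if → colour-proper e≢f ie if (proj₂ (colour e)) (proj₂ (colour f))) ,
  (λ e a → colour-extends (proj₂ (colour e)))
  where open Extension G bip k pre pre-proper pre≤k
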